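{- If $G_1$ and $G_2$ are graphs, then $$\max\{a_1(G_1), a_1(G_2)\} \le a_1(G_1\cup G_2) \le a_1(G_1)+ a_1(G_2),$$ where $G_1\cup G_2$ denotes the disjoint union of $G_1$ and $G_2$.
   Context: All graphs are finite, simple, and have at least one vertex. The disjoint union of two (vertex-disjoint) graphs $G$ and $H$ has vertex set $V(G)\cup V(H)$ and edge set $E(G)\cup E(H)$. A clique of a graph $G$ is an inclusion-wise maximal complete subgraph (an isolated vertex is a clique of size 1). The $(a,b)$-monochromatic clique transversal game ($(a,b)$-MCT game) on $G$ is played by Alice and Bob, who alternately take turns: in each of her turns Alice chooses $a$ unplayed vertices and colors them red, and in each of his turns Bob chooses $b$ unplayed vertices and colors them blue (if fewer unplayed vertices remain, the player colors all of them). Alice wins if the red vertices contain at least one vertex of each clique of $G$; Bob wins if all vertices of some clique of $G$ are blue. The game is Alice-start if Alice moves first. The threshold $a_1(G)$ is the smallest positive integer $a$ such that Alice has a winning strategy in the Alice-start $(a,1)$-MCT game on $G$. -}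

module Defs where

open import Data.Nat using (ℕ; zero; suc; _+_; _⊓_; _≤_; _<_; z≤n; s≤s; s≤s⁻¹; NonZero; >-nonZero; >-nonZero⁻¹)
import Data.Nat.Properties as ℕ
open import Data.Fin using (Fin; fromℕ<; splitAt)
import Data.Fin.Properties as Fin
open import Data.Fin.Subset
open import Data.Fin.Subset.Properties
open import Data.Product using (_×_; _,_; ∃; ∃-syntax; proj₁; proj₂)
open import Data.Sum using (inj₁; inj₂; [_,_]′)
open import Data.Sum.Relation.Binary.Pointwise using (Pointwise; ⊎-symmetric; ⊎-irreflexive; ⊎-decidable; ≡⇒Pointwise-≡)
open import Data.Vec using ([]; _∷_)
open import Function using (_∘_)
open import Level using (0ℓ)
open import Relation.Binary using (Rel; Symmetric; Irreflexive; Decidable)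
open import Relation.Binary.PropositionalEquality
open import Relation.Nullary using (¬_; Dec; yes; no; contradiction)
open import Relation.Nullary.Decidable using (map′; ¬?; _×-dec_; _→-dec_; decidable-stable)
import Relation.Unary as U

record Graph : Set₁ where
  field
    order         : ℕ
    order-nonZero : NonZero order
    Adj           : Rel (Fin order) 0ℓ
    adj?          : Decidable Adj
    adj-sym       : Symmetric Adj
    adj-irrefl    : Irreflexive _≡_ Adj

open Graph public using (order)

-- The vertices of G come first in Fin (order G + order H), followed by those
-- of H.
infixr 6 _∪ᴳ_
_∪ᴳ_ : Graph → Graph → Graph
G ∪ᴳ H = record
  { order         = m + n
  ; order-nonZero = >-nonZero (ℕ.≤-trans (>-nonZero⁻¹ m {{G.order-nonZero}}) (ℕ.m≤m+n m n))
  ; Adj           = λ x y → Pointwise G.Adj H.Adj (splitAt m x) (splitAt m y)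
  ; adj?          = λ x y → ⊎-decidable G.adj? H.adj? (splitAt m x) (splitAt m y)
  ; adj-sym       = ⊎-symmetric G.adj-sym H.adj-sym
  ; adj-irrefl    = λ x≡y → ⊎-irreflexive G.adj-irrefl H.adj-irrefl
                              (≡⇒Pointwise-≡ (cong (splitAt m) x≡y))
  }
  where
  module G = Graph G
  module H = Graph H
  m = G.order
  n = H.order

data Player : Set where
  Alice Bob : Player

VertexSet : Graph → Set
VertexSet G = Subset (order G)

module _ (G : Graph) where
  open Graph G using (Adj; adj?; order-nonZero)

  IsComplete : VertexSet G → Set
  IsComplete C = ∀ x y → x ∈ C → y ∈ C → x ≢ y → Adj x y

  -- The empty set is complete but never maximal, since G has a vertex
  -- (clique-nonempty below).
  IsClique : VertexSet G → Set
  IsClique C = IsComplete C × (∀ D → IsComplete D → C ⊆ D → D ⊆ C)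

  AliceHasWon : VertexSet G → Set
  AliceHasWon R = ∀ C → IsClique C → Nonempty (R ∩ C)

  BobHasWon : VertexSet G → Set
  BobHasWon B = ∃[ C ] IsClique C × C ⊆ B

  unplayed : (R B : VertexSet G) → VertexSet G
  unplayed R B = ∁ (R ∪ B)

  -- S may be coloured in a turn of a player who colours k vertices per turn,
  -- when R is the set of red and B the set of blue vertices.
  LegalMove : ℕ → (R B S : VertexSet G) → Set
  LegalMove k R B S = S ⊆ unplayed R B × ∣ S ∣ ≡ k ⊓ ∣ unplayed R B ∣

  -- Winning strategies for Alice in the (a,b)-MCT game from the position with
  -- red set R and blue set B, as strategy trees: one move at each of Alice's
  -- turns, a reply to every legal move at each of Bob's.  The trees are
  -- well-founded, so Alice has to win after finitely many turns; there are
  -- none once Bob has won (bob-won⇒no-strategy below).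
  data WinningStrategy (a b : ℕ) : Player → (R B : VertexSet G) → Set where
    won   : ∀ {p R B} → AliceHasWon R → WinningStrategy a b p R B
    alice : ∀ {R B} S → LegalMove a R B S →
            WinningStrategy a b Bob (R ∪ S) B → WinningStrategy a b Alice R B
    bob   : ∀ {R B} →
            (∀ S → LegalMove b R B S → WinningStrategy a b Alice R (B ∪ S)) →
            WinningStrategy a b Bob R B

  AliceWinsAliceStart : (a b : ℕ) → Set
  AliceWinsAliceStart a b = WinningStrategy a b Alice ⊥ ⊥

  IsThreshold : ℕ → Set
  IsThreshold k = 0 < k × AliceWinsAliceStart k 1 ×
                  (∀ a → 0 < a → AliceWinsAliceStart a 1 → k ≤ a)

  clique-nonempty : ∀ {C} → IsClique C → Nonempty C
  clique-nonempty {C} (_ , maximal) with nonempty? C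
  ... | yes ne = ne
  ... | no  em = v , maximal ⁅ v ⁆ complete (λ {x} x∈C → contradiction (x , x∈C) em) (x∈⁅x⁆ v)
    where
    v = fromℕ< (>-nonZero⁻¹ (order G) {{order-nonZero}})
    complete : IsComplete ⁅ v ⁆
    complete x y x∈ y∈ x≢y =
      contradiction (trans (x∈⁅y⁆⇒x≡y v x∈) (sym (x∈⁅y⁆⇒x≡y v y∈))) x≢y

  private
    legal-exists : ∀ {n} k (p : Subset n) → ∃[ S ] S ⊆ p × ∣ S ∣ ≡ k ⊓ ∣ p ∣
    legal-exists {n} zero p = ⊥ , ⊥⊆ , ∣⊥∣≡0 n
    legal-exists (suc k) [] = ⊥ , ⊥⊆ , refl
    legal-exists (suc k) (outside ∷ p) =
      let S , S⊆p , eq = legal-exists (suc k) p in outside ∷ S , s⊆s S⊆p , eq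
    legal-exists (suc k) (inside ∷ p) =
      let S , S⊆p , eq = legal-exists k p in inside ∷ S , s⊆s S⊆p , cong suc eq

  bob-won⇒no-strategy : ∀ {a b p R B} → Empty (R ∩ B) → BobHasWon B →
                        ¬ WinningStrategy a b p R B
  bob-won⇒no-strategy {R = R} dis (C , cl , C⊆B) (won w) =
    let x , x∈ = w C cl
        x∈R , x∈C = x∈p∩q⁻ R C x∈
    in dis (x , x∈p∩q⁺ (x∈R , C⊆B x∈C))
  bob-won⇒no-strategy {R = R} {B} dis bw (alice S (S⊆ , _) σ) =
    bob-won⇒no-strategy
      (λ (x , x∈) → let x∈RS , x∈B = x∈p∩q⁻ (R ∪ S) B x∈ in
        [ (λ x∈R → dis (x , x∈p∩q⁺ (x∈R , x∈B)))
        , (λ x∈S → x∈∁p⇒x∉p (S⊆ x∈S) (x∈p∪q⁺ (inj₂ x∈B))) ]′ (x∈p∪q⁻ R S x∈RS))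
      bw σ
  bob-won⇒no-strategy {b = b} {R = R} {B} dis (C , cl , C⊆B) (bob σ) =
    let S , legal@(S⊆ , _) = legal-exists b (unplayed R B) in
    bob-won⇒no-strategy
      (λ (x , x∈) → let x∈R , x∈BS = x∈p∩q⁻ R (B ∪ S) x∈ in
        [ (λ x∈B → dis (x , x∈p∩q⁺ (x∈R , x∈B)))
        , (λ x∈S → x∈∁p⇒x∉p (S⊆ x∈S) (x∈p∪q⁺ (inj₁ x∈R))) ]′ (x∈p∪q⁻ B S x∈BS))
      (C , cl , p⊆p∪q S ∘ C⊆B)
      (σ S legal)

  -- Decidability of the existence of a winning strategy, used only to obtain
  -- the least positive a for which there is one.

  private
    allSubsets? : ∀ {n ℓ} {P : U.Pred (Subset n) ℓ} → U.Decidable P → Dec (∀ S → P S)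
    allSubsets? P? with anySubset? (¬? ∘ P?)
    ... | yes (S , ¬PS) = no λ all → ¬PS (all S)
    ... | no  none      = yes λ S → decidable-stable (P? S) λ ¬PS → none (S , ¬PS)

    complete? : U.Decidable IsComplete
    complete? C = Fin.all? λ x → Fin.all? λ y →
      (x ∈? C) →-dec ((y ∈? C) →-dec (¬? (x Fin.≟ y) →-dec adj? x y))

    clique? : U.Decidable IsClique
    clique? C = complete? C ×-dec
      allSubsets? λ D → complete? D →-dec ((C ⊆? D) →-dec (D ⊆? C))

    aliceHasWon? : U.Decidable AliceHasWon
    aliceHasWon? R = allSubsets? λ C → clique? C →-dec nonempty? (R ∩ C)

    legalMove? : ∀ k R B → U.Decidable (LegalMove k R B)
    legalMove? k R B S = (S ⊆? unplayed R B) ×-dec (∣ S ∣ ℕ.≟ k ⊓ ∣ unplayed R B ∣)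

    legal-full : ∀ {k R B S} → Empty (unplayed R B) → LegalMove k R B S → S ≡ ⊥
    legal-full em (S⊆ , _) = Empty-unique λ (x , x∈S) → em (x , S⊆ x∈S)

    legal-full-exists : ∀ k R B → Empty (unplayed R B) → LegalMove k R B ⊥
    legal-full-exists k R B em = ⊥⊆ , (begin
      ∣ ⊥ {order G} ∣      ≡⟨ ∣⊥∣≡0 (order G) ⟩
      0                    ≡⟨ ℕ.⊓-zeroʳ k ⟨
      k ⊓ 0                ≡⟨ cong (k ⊓_) (∣⊥∣≡0 (order G)) ⟨
      k ⊓ ∣ ⊥ {order G} ∣  ≡⟨ cong (λ p → k ⊓ ∣ p ∣) (Empty-unique em) ⟨
      k ⊓ ∣ unplayed R B ∣ ∎)
      where open ≡-Reasoning

    full⇒won : ∀ {a b p R B} → Empty (unplayed R B) →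
               WinningStrategy a b p R B → AliceHasWon R
    full⇒won em (won w) = w
    full⇒won {R = R} {B} em (alice S legal σ) with refl ← legal-full {R = R} {B} em legal =
      subst AliceHasWon (∪-identityʳ R)
        (full⇒won (subst (λ R′ → Empty (unplayed R′ B)) (sym (∪-identityʳ R)) em) σ)
    full⇒won {b = b} {R = R} {B} em (bob σ) =
      full⇒won (subst (λ B′ → Empty (unplayed R B′)) (sym (∪-identityʳ B)) em)
               (σ ⊥ (legal-full-exists b R B em))

    legal-nonempty : ∀ {k R B S} → 0 < k → Nonempty (unplayed R B) →
                     LegalMove k R B S → Nonempty S
    legal-nonempty {k} {R} {B} {S} 0<k (x , x∈) (_ , eq) with nonempty? S
    ... | yes ne = ne
    ... | no  em = contradiction
      (subst (0 <_) (trans (sym eq) (trans (cong ∣_∣ (Empty-unique em)) (∣⊥∣≡0 (order G))))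
        (ℕ.⊓-glb 0<k 0<u))
      ℕ.n≮0
      where
      0<u : 0 < ∣ unplayed R B ∣
      0<u = subst (_≤ ∣ unplayed R B ∣) (∣⁅x⁆∣≡1 x)
              (p⊆q⇒∣p∣≤∣q∣ λ y∈ → subst (_∈ unplayed R B) (sym (x∈⁅y⁆⇒x≡y x y∈)) x∈)

    shrink : ∀ {p q : VertexSet G} {x} → p ⊆ q → x ∈ ∁ p → x ∈ q → ∣ ∁ q ∣ < ∣ ∁ p ∣
    shrink p⊆q x∈∁p x∈q = p⊂q⇒∣p∣<∣q∣ (p⊂q⇒∁p⊃∁q (p⊆q , _ , x∈q , x∈∁p⇒x∉p x∈∁p))

    alice-shrinks : ∀ {k R B S} → 0 < k → Nonempty (unplayed R B) → LegalMove k R B S →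
                    ∣ unplayed (R ∪ S) B ∣ < ∣ unplayed R B ∣
    alice-shrinks {k} {R} {B} {S} 0<k ne legal =
      let x , x∈S = legal-nonempty {R = R} {B} 0<k ne legal in
      shrink {R ∪ B} {(R ∪ S) ∪ B}
        (λ y∈ → [ (λ y∈R → p⊆p∪q B (p⊆p∪q S y∈R)) , q⊆p∪q (R ∪ S) B ]′ (x∈p∪q⁻ R B y∈))
        (proj₁ legal x∈S) (p⊆p∪q B (q⊆p∪q R S x∈S))

    bob-shrinks : ∀ {k R B S} → 0 < k → Nonempty (unplayed R B) → LegalMove k R B S →
                  ∣ unplayed R (B ∪ S) ∣ < ∣ unplayed R B ∣
    bob-shrinks {k} {R} {B} {S} 0<k ne legal =
      let x , x∈S = legal-nonempty {R = R} {B} 0<k ne legal in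
      shrink {R ∪ B} {R ∪ (B ∪ S)}
        (λ y∈ → [ p⊆p∪q (B ∪ S) , (λ y∈B → q⊆p∪q R (B ∪ S) (p⊆p∪q S y∈B)) ]′ (x∈p∪q⁻ R B y∈))
        (proj₁ legal x∈S) (q⊆p∪q R (B ∪ S) (q⊆p∪q B S x∈S))

    strategy? : ∀ {a b} → 0 < a → 0 < b → ∀ fuel p R B → ∣ unplayed R B ∣ < fuel →
                Dec (WinningStrategy a b p R B)
    strategy? 0<a 0<b (suc fuel) p R B bound with aliceHasWon? R | nonempty? (unplayed R B)
    ... | yes w | _     = yes (won w)
    ... | no ¬w | no em = no (¬w ∘ full⇒won em)
    strategy? {a} 0<a 0<b (suc fuel) Alice R B bound | no ¬w | yes ne =
      map′ (λ (S , legal , σ) → alice S legal σ)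
           (λ { (won w) → contradiction w ¬w ; (alice S legal σ) → S , legal , σ })
           (anySubset? step)
      where
      step : U.Decidable (λ S → LegalMove a R B S × WinningStrategy a _ Bob (R ∪ S) B)
      step S with legalMove? a R B S
      ... | no ¬l = no (¬l ∘ proj₁)
      ... | yes l = map′ (l ,_) proj₂
        (strategy? 0<a 0<b fuel Bob (R ∪ S) B
          (ℕ.<-≤-trans (alice-shrinks {R = R} {B} 0<a ne l) (s≤s⁻¹ bound)))
    strategy? {b = b} 0<a 0<b (suc fuel) Bob R B bound | no ¬w | yes ne =
      map′ bob (λ { (won w) → contradiction w ¬w ; (bob σ) → σ }) (allSubsets? step)
      where
      step : U.Decidable (λ S → LegalMove b R B S → WinningStrategy _ b Alice R (B ∪ S))
      step S with legalMove? b R B S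
      ... | no ¬l = yes λ l → contradiction l ¬l
      ... | yes l = map′ (λ σ _ → σ) (λ f → f l)
        (strategy? 0<a 0<b fuel Alice R (B ∪ S)
          (ℕ.<-≤-trans (bob-shrinks {R = R} {B} 0<b ne l) (s≤s⁻¹ bound)))

    wins? : ∀ a → 0 < a → Dec (AliceWinsAliceStart a 1)
    wins? a 0<a = strategy? 0<a (s≤s z≤n) _ Alice ⊥ ⊥ (ℕ.n<1+n _)

    order-wins : AliceWinsAliceStart (order G) 1
    order-wins = alice ⊤ (all-unplayed , size)
      (won λ C cl → let x , x∈C = clique-nonempty cl in
        x , x∈p∩q⁺ (x∈p∪q⁺ (inj₂ ∈⊤) , x∈C))
      where
      all-unplayed : ⊤ ⊆ unplayed ⊥ ⊥
      all-unplayed _ = x∉p⇒x∈∁p λ x∈ → [ ∉⊥ , ∉⊥ ]′ (x∈p∪q⁻ ⊥ ⊥ x∈)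

      size : ∣ ⊤ {order G} ∣ ≡ order G ⊓ ∣ unplayed ⊥ ⊥ ∣
      size = begin
        ∣ ⊤ {order G} ∣           ≡⟨ ∣⊤∣≡n (order G) ⟩
        order G                   ≡⟨ ℕ.⊓-idem (order G) ⟨
        order G ⊓ order G         ≡⟨ cong (order G ⊓_) (∣⊤∣≡n (order G)) ⟨
        order G ⊓ ∣ ⊤ {order G} ∣ ≡⟨ cong (λ p → order G ⊓ ∣ p ∣) (⊆-antisym all-unplayed ⊆⊤) ⟩
        order G ⊓ ∣ unplayed ⊥ ⊥ ∣ ∎
        where open ≡-Reasoning

    search : ∀ fuel k → 0 < k → (∀ a → 0 < a → AliceWinsAliceStart a 1 → k ≤ a) →
             order G < k + fuel → ∃ IsThreshold
    search zero k 0<k least bound = contradiction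
      (least (order G) (>-nonZero⁻¹ _ {{order-nonZero}}) order-wins)
      (ℕ.<⇒≱ (subst (order G <_) (ℕ.+-identityʳ k) bound))
    search (suc fuel) k 0<k least bound with wins? k 0<k
    ... | yes w = k , 0<k , w , least
    ... | no ¬w = search fuel (suc k) (s≤s z≤n)
      (λ a 0<a w → ℕ.≤∧≢⇒< (least a 0<a w) λ { refl → ¬w w })
      (subst (order G <_) (ℕ.+-suc k fuel) bound)

  threshold : ∃ IsThreshold
  threshold = search (order G) 1 (s≤s z≤n) (λ _ 0<a _ → 0<a) (ℕ.n<1+n _)

  a₁ : ℕ
  a₁ = proj₁ threshold

  a₁-isThreshold : IsThreshold a₁
  a₁-isThreshold = proj₂ threshold

{-# OPTIONS --safe #-}

-- A winning strategy is turned into an invariant of positions and back.  Alice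
-- wins as soon as she can maintain an invariant that forces her to have won
-- once every vertex is played.  The invariant used here is that of a virtual
-- game on another graph that Alice is winning and in which, along a partial
-- bijection of the vertices, every virtual red vertex is really red and every
-- really blue vertex is virtually blue.  For the lower bound the virtual game
-- is played on G₁ ∪ G₂ and the real one on a component; for the upper bound
-- two virtual games on G₁ and G₂ are played in parallel, Alice having enough
-- moves for both.
module Submission where

open import Defs
open import Data.Fin using (Fin; zero; suc; _↑ˡ_; _↑ʳ_; splitAt)
import Data.Fin.Properties as Fin
open import Data.Fin.Subset
open import Data.Fin.Subset.Properties
open import Data.Nat using (ℕ; zero; suc; _+_; _⊓_; _⊔_; _≤_; _<_; z≤n; s≤s; s≤s⁻¹)
import Data.Nat.Properties as ℕ
open import Data.Product using (_×_; _,_; ∃-syntax; proj₁; proj₂)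
open import Data.Sum using (inj₁; inj₂; [_,_]′)
open import Data.Sum.Relation.Binary.Pointwise using (Pointwise; inj₁; inj₂)
open import Data.Vec using ([]; _∷_; here; there; lookup; tabulate)
open import Data.Vec.Properties using (lookup∘tabulate; []=⇒lookup; lookup⇒[]=)
open import Function using (_∘_; id)
open import Function.Definitions using (Injective)
open import Relation.Binary.PropositionalEquality
open import Relation.Nullary using (yes; no; contradiction)

-- Subsets of Fin n

∪-lub : ∀ {n} {p q r : Subset n} → p ⊆ r → q ⊆ r → p ∪ q ⊆ r
∪-lub {p = p} {q} p⊆r q⊆r x∈ = [ p⊆r , q⊆r ]′ (x∈p∪q⁻ p q x∈)

x∈∁[p∪q]⁺ : ∀ {n} {p q : Subset n} {x} → x ∉ p → x ∉ q → x ∈ ∁ (p ∪ q)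
x∈∁[p∪q]⁺ {p = p} {q} x∉p x∉q = x∉p⇒x∈∁p λ x∈ → [ x∉p , x∉q ]′ (x∈p∪q⁻ p q x∈)

x∈∁[p∪q]⇒x∉p : ∀ {n} {p q : Subset n} {x} → x ∈ ∁ (p ∪ q) → x ∉ p
x∈∁[p∪q]⇒x∉p {q = q} x∈ x∈p = x∈∁p⇒x∉p x∈ (p⊆p∪q q x∈p)

x∈∁[p∪q]⇒x∉q : ∀ {n} {p q : Subset n} {x} → x ∈ ∁ (p ∪ q) → x ∉ q
x∈∁[p∪q]⇒x∉q {p = p} {q} x∈ x∈q = x∈∁p⇒x∉p x∈ (q⊆p∪q p q x∈q)

∣p∪q∣≤∣p∣+∣q∣ : ∀ {n} (p q : Subset n) → ∣ p ∪ q ∣ ≤ ∣ p ∣ + ∣ q ∣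
∣p∪q∣≤∣p∣+∣q∣ []            []            = z≤n
∣p∪q∣≤∣p∣+∣q∣ (outside ∷ p) (outside ∷ q) = ∣p∪q∣≤∣p∣+∣q∣ p q
∣p∪q∣≤∣p∣+∣q∣ (outside ∷ p) (inside ∷ q)  =
  subst (suc ∣ p ∪ q ∣ ≤_) (sym (ℕ.+-suc ∣ p ∣ ∣ q ∣)) (s≤s (∣p∪q∣≤∣p∣+∣q∣ p q))
∣p∪q∣≤∣p∣+∣q∣ (inside ∷ p)  (s ∷ q)       =
  s≤s (ℕ.≤-trans (∣p∪q∣≤∣p∣+∣q∣ p q) (ℕ.+-monoʳ-≤ ∣ p ∣ (∣p∣≤∣x∷p∣ s q)))

-- Pads a choice of at most `k` vertices of `p` to a legal move, so that strategies need only name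
-- the vertices that matter.
extend : ∀ {n} k {p q : Subset n} → q ⊆ p → ∣ q ∣ ≤ k →
         ∃[ r ] q ⊆ r × r ⊆ p × ∣ r ∣ ≡ k ⊓ ∣ p ∣
extend {n} zero {p} {q} q⊆p ∣q∣≤0 = q , id , q⊆p , ℕ.n≤0⇒n≡0 ∣q∣≤0
extend (suc k) {[]} {[]} _ _ = [] , id , id , refl
extend (suc k) {outside ∷ p} {inside ∷ q} q⊆p _ with () ← q⊆p here
extend (suc k) {outside ∷ p} {outside ∷ q} q⊆p ∣q∣≤k =
  let r , q⊆r , r⊆p , eq = extend (suc k) {p} {q} (drop-∷-⊆ q⊆p) ∣q∣≤k in
  outside ∷ r , s⊆s q⊆r , s⊆s r⊆p , eq
extend (suc k) {inside ∷ p} {inside ∷ q} q⊆p ∣q∣≤k =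
  let r , q⊆r , r⊆p , eq = extend k {p} {q} (drop-∷-⊆ q⊆p) (s≤s⁻¹ ∣q∣≤k) in
  inside ∷ r , s⊆s q⊆r , s⊆s r⊆p , cong suc eq
extend (suc k) {inside ∷ p} {outside ∷ q} q⊆p ∣q∣≤1+k with ∣ q ∣ ℕ.≤? k
... | yes ∣q∣≤k =
  let r , q⊆r , r⊆p , eq = extend k {p} {q} (drop-∷-⊆ q⊆p) ∣q∣≤k in
  inside ∷ r , out⊆ q⊆r , s⊆s r⊆p , cong suc eq
-- Here `q` already has `suc k` elements, so there is no room for the head of the larger set.
... | no ∣q∣≰k = outside ∷ q , id , q⊆p , trans ∣q∣≡1+k (cong suc (sym (ℕ.m≤n⇒m⊓n≡m k≤∣p∣)))
  where
  ∣q∣≡1+k : ∣ q ∣ ≡ suc k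
  ∣q∣≡1+k = ℕ.≤-antisym ∣q∣≤1+k (ℕ.≰⇒> ∣q∣≰k)

  k≤∣p∣ : k ≤ ∣ p ∣
  k≤∣p∣ = ℕ.≤-trans (ℕ.<⇒≤ (ℕ.≰⇒> ∣q∣≰k)) (p⊆q⇒∣p∣≤∣q∣ {p = q} {p} (drop-∷-⊆ q⊆p))

-- Termination measure: with `p` and `q` the played vertices before and after a nonempty move `S`,
-- fewer vertices are left to play.
∁-shrinks : ∀ {n} {p q S : Subset n} → p ⊆ q → S ⊆ q → S ⊆ ∁ p → 0 < ∣ S ∣ →
            ∣ ∁ q ∣ < ∣ ∁ p ∣
∁-shrinks {n} {S = S} p⊆q S⊆q S⊆∁p 0<∣S∣ with nonempty? S
... | yes (x , x∈S) = p⊂q⇒∣p∣<∣q∣ (p⊂q⇒∁p⊃∁q (p⊆q , x , S⊆q x∈S , x∈∁p⇒x∉p (S⊆∁p x∈S)))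
... | no  empty     =
  contradiction (trans (cong ∣_∣ (Empty-unique empty)) (∣⊥∣≡0 n)) (ℕ.m<n⇒n≢0 0<∣S∣)

nonempty⇒∣p∣>0 : ∀ {n} {p : Subset n} → Nonempty p → 0 < ∣ p ∣
nonempty⇒∣p∣>0 {p = p} (x , x∈p) = subst (_≤ ∣ p ∣) (∣⁅x⁆∣≡1 x)
  (p⊆q⇒∣p∣≤∣q∣ λ y∈ → subst (_∈ p) (sym (x∈⁅y⁆⇒x≡y x y∈)) x∈p)

-- Images and preimages

image : ∀ {m n} → (Fin m → Fin n) → Subset m → Subset n
image f []            = ⊥
image f (inside ∷ S)  = ⁅ f zero ⁆ ∪ image (f ∘ suc) S
image f (outside ∷ S) = image (f ∘ suc) S

preimage : ∀ {m n} → (Fin m → Fin n) → Subset n → Subset m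
preimage f T = tabulate (lookup T ∘ f)

∈image⁺ : ∀ {m n} (f : Fin m → Fin n) {S x} → x ∈ S → f x ∈ image f S
∈image⁺ f {inside ∷ S}  here       = p⊆p∪q (image (f ∘ suc) S) (x∈⁅x⁆ (f zero))
∈image⁺ f {inside ∷ S}  (there x∈) = q⊆p∪q ⁅ f zero ⁆ _ (∈image⁺ (f ∘ suc) x∈)
∈image⁺ f {outside ∷ S} (there x∈) = ∈image⁺ (f ∘ suc) x∈

∈image⁻ : ∀ {m n} (f : Fin m → Fin n) S {y} → y ∈ image f S → ∃[ x ] f x ≡ y × x ∈ S
∈image⁻ f []            y∈ = contradiction y∈ ∉⊥
∈image⁻ f (outside ∷ S) y∈ =
  let x , fx≡y , x∈S = ∈image⁻ (f ∘ suc) S y∈ in suc x , fx≡y , there x∈S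
∈image⁻ f (inside ∷ S)  y∈ with x∈p∪q⁻ ⁅ f zero ⁆ (image (f ∘ suc) S) y∈
... | inj₁ y∈⁅f0⁆ = zero , sym (x∈⁅y⁆⇒x≡y (f zero) y∈⁅f0⁆) , here
... | inj₂ y∈img  =
  let x , fx≡y , x∈S = ∈image⁻ (f ∘ suc) S y∈img in suc x , fx≡y , there x∈S

∈preimage⁺ : ∀ {m n} (f : Fin m → Fin n) {T x} → f x ∈ T → x ∈ preimage f T
∈preimage⁺ f {T} {x} fx∈T =
  lookup⇒[]= x _ (trans (lookup∘tabulate (lookup T ∘ f) x) ([]=⇒lookup fx∈T))

∈preimage⁻ : ∀ {m n} (f : Fin m → Fin n) {T x} → x ∈ preimage f T → f x ∈ T
∈preimage⁻ f {T} {x} x∈ =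
  lookup⇒[]= (f x) T (trans (sym (lookup∘tabulate (lookup T ∘ f) x)) ([]=⇒lookup x∈))

∣image∣≤ : ∀ {m n} (f : Fin m → Fin n) S → ∣ image f S ∣ ≤ ∣ S ∣
∣image∣≤ {n = n} f []    = ℕ.≤-reflexive (∣⊥∣≡0 n)
∣image∣≤ f (outside ∷ S) = ∣image∣≤ (f ∘ suc) S
∣image∣≤ f (inside ∷ S)  = ℕ.≤-trans (∣p∪q∣≤∣p∣+∣q∣ ⁅ f zero ⁆ (image (f ∘ suc) S))
  (ℕ.+-mono-≤ (ℕ.≤-reflexive (∣⁅x⁆∣≡1 (f zero))) (∣image∣≤ (f ∘ suc) S))

-- By injectivity the value at the head is missing from the image of the tail, so each member of `S`
-- contributes a new element.
∣image∣≥ : ∀ {m n} {f : Fin m → Fin n} → Injective _≡_ _≡_ f → ∀ S → ∣ S ∣ ≤ ∣ image f S ∣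
∣image∣≥ inj []            = z≤n
∣image∣≥ inj (outside ∷ S) = ∣image∣≥ (Fin.suc-injective ∘ inj) S
∣image∣≥ {f = f} inj (inside ∷ S) =
  ℕ.≤-<-trans (∣image∣≥ (Fin.suc-injective ∘ inj) S)
    (p⊂q⇒∣p∣<∣q∣ (q⊆p∪q ⁅ f zero ⁆ (image (f ∘ suc) S) , f zero ,
                  p⊆p∪q (image (f ∘ suc) S) (x∈⁅x⁆ (f zero)) , f0∉))
  where
  f0∉ : f zero ∉ image (f ∘ suc) S
  f0∉ f0∈ with ∈image⁻ (f ∘ suc) S f0∈
  ... | x , eq , _ with () ← inj eq

∣preimage∣≤ : ∀ {m n} {f : Fin m → Fin n} → Injective _≡_ _≡_ f → ∀ T → ∣ preimage f T ∣ ≤ ∣ T ∣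
∣preimage∣≤ {f = f} inj T = ℕ.≤-trans (∣image∣≥ inj (preimage f T))
  (p⊆q⇒∣p∣≤∣q∣ λ y∈ →
    let x , fx≡y , x∈ = ∈image⁻ f (preimage f T) y∈ in subst (_∈ T) fx≡y (∈preimage⁻ f x∈))

-- Winning strategies and invariants

module _ {G : Graph} where

  AliceHasWon-mono : ∀ {R R′} → R ⊆ R′ → AliceHasWon G R → AliceHasWon G R′
  AliceHasWon-mono {R} R⊆R′ w C cl =
    let x , x∈R∩C = w C cl
        x∈R , x∈C = x∈p∩q⁻ R C x∈R∩C
    in x , x∈p∩q⁺ (R⊆R′ x∈R , x∈C)

  -- Follow one branch of the strategy to a leaf. Alice only ever colours vertices outside `B`, all
  -- of which lie in `R′`, and the growth of `B` only weakens the covering condition. Hence the red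
  -- set at the leaf is contained in `R′`.
  strategy⇒cover-won : ∀ {a b p R R′ B} → WinningStrategy G a b p R B →
                       R ⊆ R′ → (∀ {x} → x ∉ B → x ∈ R′) → AliceHasWon G R′
  strategy⇒cover-won (won w) R⊆R′ _ = AliceHasWon-mono R⊆R′ w
  strategy⇒cover-won (alice S (S⊆ , _) σ) R⊆R′ cover =
    strategy⇒cover-won σ (∪-lub R⊆R′ λ x∈S → cover (x∈∁[p∪q]⇒x∉q (S⊆ x∈S))) cover
  strategy⇒cover-won {b = b} {R = R} {B = B} (bob σ) R⊆R′ cover =
    -- Any legal reply of Bob will do; this one is obtained by padding the empty set.
    let T , _ , legal = extend b {unplayed G R B} {⊥} ⊥⊆ (subst (_≤ b) (sym (∣⊥∣≡0 (order G))) z≤n) in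
    strategy⇒cover-won (σ T legal) R⊆R′ λ x∉B∪T → cover (x∉B∪T ∘ p⊆p∪q T)

-- Moves are bounded in size rather than exact, and `alice-step` must tolerate every larger red set.
-- This absorbs the padding to a legal move and lets two invariants share one turn.
record Invariant (G : Graph) (a b : ℕ) (I : Player → (R B : VertexSet G) → Set) : Set where
  field
    alice-step : ∀ {R B} → I Alice R B →
                 ∃[ S ] S ⊆ unplayed G R B × ∣ S ∣ ≤ a ×
                        (∀ {R′} → R ⊆ R′ → S ⊆ R′ → I Bob R′ B)
    bob-step   : ∀ {R B T} → I Bob R B → T ⊆ unplayed G R B → ∣ T ∣ ≤ b → I Alice R (B ∪ T)
    full⇒won   : ∀ {p R B} → I p R B → Empty (unplayed G R B) → AliceHasWon G R

-- Induction on the number of unplayed vertices: since `a` and `b` are positive, every turn strictly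
-- decreases it until the board is full.
invariant⇒strategy : ∀ {G a b I} → 0 < a → 0 < b → Invariant G a b I →
                     ∀ {p R B} → I p R B → WinningStrategy G a b p R B
invariant⇒strategy {G} {a} {b} {I} 0<a 0<b inv = go _ (ℕ.n<1+n _)
  where
  open Invariant inv

  legal>0 : ∀ {k R B S} → 0 < k → Nonempty (unplayed G R B) → LegalMove G k R B S → 0 < ∣ S ∣
  legal>0 0<k ne (_ , eq) = subst (0 <_) (sym eq) (ℕ.⊓-glb 0<k (nonempty⇒∣p∣>0 ne))

  go : ∀ fuel {p R B} → ∣ unplayed G R B ∣ < fuel → I p R B → WinningStrategy G a b p R B
  go (suc fuel) {R = R} {B} bound i with nonempty? (unplayed G R B)
  ... | no empty = won (full⇒won i empty)
  go (suc fuel) {Alice} {R} {B} bound i | yes ne =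
    let S₀ , S₀⊆ , ∣S₀∣≤a , next = alice-step i
        S , S₀⊆S , legal = extend a {q = S₀} S₀⊆ ∣S₀∣≤a
        shrinks = ∁-shrinks {p = R ∪ B} {(R ∪ S) ∪ B}
          (∪-lub (p⊆p∪q B ∘ p⊆p∪q S) (q⊆p∪q (R ∪ S) B))
          (p⊆p∪q B ∘ q⊆p∪q R S) (proj₁ legal) (legal>0 {R = R} {B} 0<a ne legal)
    in alice S legal (go fuel (ℕ.<-≤-trans shrinks (s≤s⁻¹ bound))
                        (next (p⊆p∪q S) (q⊆p∪q R S ∘ S₀⊆S)))
  go (suc fuel) {Bob} {R} {B} bound i | yes ne = bob λ T legal →
    let shrinks = ∁-shrinks {p = R ∪ B} {R ∪ (B ∪ T)}
          (∪-lub (p⊆p∪q (B ∪ T)) (q⊆p∪q R (B ∪ T) ∘ p⊆p∪q T))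
          (q⊆p∪q R (B ∪ T) ∘ q⊆p∪q B T) (proj₁ legal) (legal>0 {R = R} {B} 0<b ne legal)
    in go fuel (ℕ.<-≤-trans shrinks (s≤s⁻¹ bound))
         (bob-step i (proj₁ legal)
            (subst (_≤ b) (sym (proj₂ legal)) (ℕ.m⊓n≤m b ∣ unplayed G R B ∣)))

-- Virtual games

-- _~_ is meant to be a partial bijection; this is only used through the two
-- bounds on cardinalities.
record Link (m n : ℕ) : Set₁ where
  field
    _~_    : Fin m → Fin n → Set
    up     : Subset m → Subset n
    down   : Subset n → Subset m
    ∈up⁺   : ∀ {S x y} → x ~ y → x ∈ S → y ∈ up S
    ∈down⁺ : ∀ {T x y} → x ~ y → y ∈ T → x ∈ down T
    ∈up⁻   : ∀ {S y} → y ∈ up S → ∃[ x ] x ~ y × x ∈ S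
    ∈down⁻ : ∀ {T x} → x ∈ down T → ∃[ y ] x ~ y × y ∈ T
    ∣up∣≤   : ∀ S → ∣ up S ∣ ≤ ∣ S ∣
    ∣down∣≤ : ∀ T → ∣ down T ∣ ≤ ∣ T ∣

flip : ∀ {m n} → Link m n → Link n m
flip L = record
  { _~_ = λ x y → y ~ x ; up = down ; down = up
  ; ∈up⁺ = ∈down⁺ ; ∈down⁺ = ∈up⁺ ; ∈up⁻ = ∈down⁻ ; ∈down⁻ = ∈up⁻
  ; ∣up∣≤ = ∣down∣≤ ; ∣down∣≤ = ∣up∣≤ }
  where open Link L

injection⇒link : ∀ {m n} {f : Fin m → Fin n} → Injective _≡_ _≡_ f → Link m n
injection⇒link {f = f} inj = record
  { _~_    = λ x y → f x ≡ y
  ; up     = image f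
  ; down   = preimage f
  ; ∈up⁺   = λ { refl → ∈image⁺ f }
  ; ∈down⁺ = λ { refl → ∈preimage⁺ f }
  ; ∈up⁻   = ∈image⁻ f _
  ; ∈down⁻ = λ x∈ → _ , refl , ∈preimage⁻ f x∈
  ; ∣up∣≤   = ∣image∣≤ f
  ; ∣down∣≤ = ∣preimage∣≤ inj
  }

module _ (G H : Graph) (L : Link (order G) (order H)) (a b : ℕ) where
  open Link L

  -- The positions are compared by inclusions only, because padding may add real red vertices on
  -- Alice's turns and virtual blue vertices on Bob's.
  record Shadow (p : Player) (R B : VertexSet H) : Set where
    constructor shadow
    field
      {R̃ B̃}    : VertexSet G
      strategy : WinningStrategy G a b p R̃ B̃
      red      : ∀ {x y} → x ~ y → x ∈ R̃ → y ∈ R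
      blue     : ∀ {x y} → x ~ y → y ∈ B → x ∈ B̃

  shadow-alice : ∀ {R B} → Shadow Alice R B →
                 ∃[ S ] S ⊆ unplayed H R B × ∣ S ∣ ≤ a ×
                        (∀ {R′} → R ⊆ R′ → S ⊆ R′ → Shadow Bob R′ B)
  shadow-alice (shadow (won w) red blue) =
    -- Once the virtual game is won, it demands no further move.
    ⊥ , ⊥⊆ , subst (_≤ a) (sym (∣⊥∣≡0 (order H))) z≤n ,
    λ R⊆R′ _ → shadow (won w) (λ x~y x∈ → R⊆R′ (red x~y x∈)) blue
  shadow-alice {R} {B} (shadow {R̃} (alice S (S⊆ , ∣S∣≡) σ) red blue) =
    -- The virtual move is carried over, without the vertices that are already played.
    up S ∩ unplayed H R B ,
    p∩q⊆q (up S) (unplayed H R B) ,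
    ℕ.≤-trans (∣p∩q∣≤∣p∣ (up S) (unplayed H R B))
      (ℕ.≤-trans (∣up∣≤ S) (subst (_≤ a) (sym ∣S∣≡) (ℕ.m⊓n≤m a _))) ,
    λ {R′} R⊆R′ S′⊆R′ → shadow σ
      (λ {x} {y} x~y x∈ → [ R⊆R′ ∘ red x~y , (λ x∈S → reply R⊆R′ S′⊆R′ x~y x∈S) ]′ (x∈p∪q⁻ R̃ S x∈))
      blue
    where
    -- A counterpart of a vertex of `S` cannot be really blue, for `S` would then contain a
    -- virtually blue vertex. So a counterpart that was left out is already red.
    reply : ∀ {R′ x y} → R ⊆ R′ → up S ∩ unplayed H R B ⊆ R′ → x ~ y → x ∈ S → y ∈ R′
    reply {y = y} R⊆R′ S′⊆R′ x~y x∈S with y ∈? R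
    ... | yes y∈R = R⊆R′ y∈R
    ... | no  y∉R = S′⊆R′ (x∈p∩q⁺ (∈up⁺ x~y x∈S ,
                      x∈∁[p∪q]⁺ y∉R λ y∈B → x∈∁[p∪q]⇒x∉q (S⊆ x∈S) (blue x~y y∈B)))

  shadow-bob : ∀ {R B T} → Shadow Bob R B → T ⊆ unplayed H R B → ∣ T ∣ ≤ b →
               Shadow Alice R (B ∪ T)
  shadow-bob {B = B} {T} (shadow {B̃ = B̃} (won w) red blue) _ _ =
    -- A virtual game that is won puts no condition on its blue set, which may grow without a legal
    -- move.
    shadow {B̃ = B̃ ∪ down T} (won w) red
      λ x~y y∈ → [ p⊆p∪q (down T) ∘ blue x~y , q⊆p∪q B̃ (down T) ∘ ∈down⁺ x~y ]′ (x∈p∪q⁻ B T y∈)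
  shadow-bob {B = B} {T} (shadow {R̃} {B̃} (bob σ) red blue) T⊆ ∣T∣≤b =
    -- Bob's virtual move contains the unplayed counterparts of his real one. If there are none, it
    -- consists of padding alone.
    let T′ , sub , legal = extend b {q = down T ∩ unplayed G R̃ B̃}
          (p∩q⊆q (down T) (unplayed G R̃ B̃))
          (ℕ.≤-trans (∣p∩q∣≤∣p∣ (down T) (unplayed G R̃ B̃)) (ℕ.≤-trans (∣down∣≤ T) ∣T∣≤b))
    in shadow (σ T′ legal) red
         λ x~y y∈ → [ p⊆p∪q T′ ∘ blue x~y , reply sub x~y ]′ (x∈p∪q⁻ B T y∈)
    where
    -- A counterpart of a vertex of `T` cannot be virtually red, for `T` would then contain a really
    -- red vertex. So it is already blue or belongs to `T′`.
    reply : ∀ {T′ x y} → down T ∩ unplayed G R̃ B̃ ⊆ T′ → x ~ y → y ∈ T → x ∈ B̃ ∪ T′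
    reply {T′} {x} sub x~y y∈T with x ∈? B̃
    ... | yes x∈B̃ = p⊆p∪q T′ x∈B̃
    ... | no  x∉B̃ = q⊆p∪q B̃ T′ (sub (x∈p∩q⁺ (∈down⁺ x~y y∈T ,
                      x∈∁[p∪q]⁺ (λ x∈R̃ → x∈∁[p∪q]⇒x∉p (T⊆ y∈T) (red x~y x∈R̃)) x∉B̃)))

  shadow-full : ∀ {p R B} → Shadow p R B → Empty (unplayed H R B) →
                ∃[ R* ] AliceHasWon G R* × (∀ {x y} → x ~ y → x ∈ R* → y ∈ R)
  shadow-full {R = R} {B} (shadow {R̃} {B̃} σ red blue) full =
    -- The virtual game may be unfinished when the real one is full. Every vertex that is not
    -- virtually blue is counted as red: its counterpart is not really blue, hence it is red.
    R̃ ∪ ∁ B̃ ,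
    strategy⇒cover-won σ (p⊆p∪q (∁ B̃)) (λ x∉B̃ → q⊆p∪q R̃ (∁ B̃) (x∉p⇒x∈∁p x∉B̃)) ,
    λ x~y x∈ → [ red x~y , red-outside x~y ]′ (x∈p∪q⁻ R̃ (∁ B̃) x∈)
    where
    red-outside : ∀ {x y} → x ~ y → x ∈ ∁ B̃ → y ∈ R
    red-outside {y = y} x~y x∈∁B̃ with y ∈? R
    ... | yes y∈R = y∈R
    ... | no  y∉R = contradiction
      (y , x∈∁[p∪q]⁺ y∉R λ y∈B → x∈∁p⇒x∉p x∈∁B̃ (blue x~y y∈B)) full

  shadow-start : AliceWinsAliceStart G a b → Shadow Alice ⊥ ⊥
  shadow-start σ = shadow σ (λ _ x∈ → contradiction x∈ ∉⊥) (λ _ y∈ → contradiction y∈ ∉⊥)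

-- Cliques of a disjoint union

-- An embedding of G onto a union of connected components of K.
record Component (G K : Graph) : Set where
  module G = Graph G
  module K = Graph K
  field
    ι         : Fin (order G) → Fin (order K)
    injective : Injective _≡_ _≡_ ι
    adj⁺      : ∀ {x y} → G.Adj x y → K.Adj (ι x) (ι y)
    adj⁻      : ∀ {x y} → K.Adj (ι x) (ι y) → G.Adj x y
    closed    : ∀ {x z} → K.Adj (ι x) z → ∃[ y ] ι y ≡ z

module _ {G K : Graph} (E : Component G K) where
  open Component E

  link : Link (order G) (order K)
  link = injection⇒link injective

  image-complete : ∀ {C} → IsComplete G C → IsComplete K (image ι C)
  image-complete {C} complete y y′ y∈ y′∈ y≢y′
    with x , refl , x∈C ← ∈image⁻ ι C y∈ | x′ , refl , x′∈C ← ∈image⁻ ι C y′∈ =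
    adj⁺ (complete x x′ x∈C x′∈C (y≢y′ ∘ cong ι))

  preimage-complete : ∀ {D} → IsComplete K D → IsComplete G (preimage ι D)
  preimage-complete complete x x′ x∈ x′∈ x≢x′ =
    adj⁻ (complete (ι x) (ι x′) (∈preimage⁻ ι x∈) (∈preimage⁻ ι x′∈) (x≢x′ ∘ injective))

  complete-meeting⊆range : ∀ {D v y} → IsComplete K D → ι v ∈ D → y ∈ D → ∃[ x ] ι x ≡ y
  complete-meeting⊆range {v = v} {y} complete v∈D y∈D with ι v Fin.≟ y
  ... | yes eq  = v , eq
  ... | no  neq = closed (complete (ι v) y v∈D y∈D neq)

  -- As `C` is nonempty, a complete set containing its image meets the range of `ι` and thus lies in
  -- it, so the maximality of `C` applies to its preimage.
  image-clique : ∀ {C} → IsClique G C → IsClique K (image ι C)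
  image-clique {C} cl@(complete , maximal) = image-complete complete , λ D D-complete C⊆D y∈D →
    let v , v∈C = clique-nonempty G cl
        x , ιx≡y = complete-meeting⊆range D-complete (C⊆D (∈image⁺ ι v∈C)) y∈D
        x∈C = maximal (preimage ι D) (preimage-complete D-complete)
                (λ z∈C → ∈preimage⁺ ι (C⊆D (∈image⁺ ι z∈C)))
                (∈preimage⁺ ι (subst (_∈ D) (sym ιx≡y) y∈D))
    in subst (_∈ image ι C) ιx≡y (∈image⁺ ι x∈C)

  -- The vertex `ι v` keeps all of `D` inside the range of `ι`, so `D` is recovered from its
  -- preimage and its maximality can be used on images.
  preimage-clique : ∀ {D v} → IsClique K D → ι v ∈ D → IsClique G (preimage ι D)
  preimage-clique {D} (complete , maximal) v∈D = preimage-complete complete , λ C C-complete D⊆C x∈C →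
    ∈preimage⁺ ι (maximal (image ι C) (image-complete C-complete)
      (λ y∈D → let x , ιx≡y = complete-meeting⊆range complete v∈D y∈D in
        subst (_∈ image ι C) ιx≡y
          (∈image⁺ ι (D⊆C (∈preimage⁺ ι (subst (_∈ D) (sym ιx≡y) y∈D)))))
      (∈image⁺ ι x∈C))

  component-wins : ∀ {a b} → 0 < a → 0 < b → AliceWinsAliceStart K a b → AliceWinsAliceStart G a b
  -- The link is flipped because the virtual game is the one on the larger graph `K`.
  component-wins {a} {b} 0<a 0<b σ = invariant⇒strategy {I = Shadow K G (flip link) a b} 0<a 0<b
    record
      { alice-step = shadow-alice K G (flip link) a b
      ; bob-step   = shadow-bob K G (flip link) a b
      ; full⇒won   = λ i full C cl →
          let R* , w , red = shadow-full K G (flip link) a b i full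
              y , y∈ = w (image ι C) (image-clique cl)
              y∈R* , y∈image = x∈p∩q⁻ R* (image ι C) y∈
              x , ιx≡y , x∈C = ∈image⁻ ι C y∈image
          in x , x∈p∩q⁺ (red ιx≡y y∈R* , x∈C)
      }
    (shadow-start K G (flip link) a b σ)

  component-clique-red : ∀ {a b p R B D v} → Shadow G K link a b p R B → Empty (unplayed K R B) →
                         IsClique K D → ι v ∈ D → Nonempty (R ∩ D)
  component-clique-red {a} {b} {D = D} i full cl v∈D =
    let R* , w , red = shadow-full G K link a b i full
        x , x∈ = w (preimage ι D) (preimage-clique cl v∈D)
        x∈R* , x∈pre = x∈p∩q⁻ R* (preimage ι D) x∈
    in ι x , x∈p∩q⁺ (red refl x∈R* , ∈preimage⁻ ι x∈pre)

-- The two sides of a disjoint union and parallel play on them.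

module _ (G H : Graph) where
  private
    m = order G
    n = order H
    module G = Graph G
    module H = Graph H

  left : Component G (G ∪ᴳ H)
  left = record
    { ι         = _↑ˡ n
    ; injective = Fin.↑ˡ-injective n _ _
    ; adj⁺      = λ {x} {y} xy → subst₂ (Pointwise G.Adj H.Adj)
                    (sym (Fin.splitAt-↑ˡ m x n)) (sym (Fin.splitAt-↑ˡ m y n)) (inj₁ xy)
    ; adj⁻      = λ {x} {y} → drop x y
    ; closed    = λ {x} {z} → stay x z
    }
    where
    drop : ∀ x y → Graph.Adj (G ∪ᴳ H) (x ↑ˡ n) (y ↑ˡ n) → G.Adj x y
    drop x y xy rewrite Fin.splitAt-↑ˡ m x n | Fin.splitAt-↑ˡ m y n with inj₁ adj ← xy = adj

    stay : ∀ x z → Graph.Adj (G ∪ᴳ H) (x ↑ˡ n) z → ∃[ y ] y ↑ˡ n ≡ z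
    stay x z xz rewrite Fin.splitAt-↑ˡ m x n with splitAt m z in eq | xz
    -- `Pointwise` has no constructor joining the two sides, so a neighbour stays on the left.
    ... | inj₁ y | inj₁ _ = y , Fin.splitAt⁻¹-↑ˡ eq

  right : Component H (G ∪ᴳ H)
  right = record
    { ι         = m ↑ʳ_
    ; injective = Fin.↑ʳ-injective m _ _
    ; adj⁺      = λ {x} {y} xy → subst₂ (Pointwise G.Adj H.Adj)
                    (sym (Fin.splitAt-↑ʳ m n x)) (sym (Fin.splitAt-↑ʳ m n y)) (inj₂ xy)
    ; adj⁻      = λ {x} {y} → drop x y
    ; closed    = λ {x} {z} → stay x z
    }
    where
    drop : ∀ x y → Graph.Adj (G ∪ᴳ H) (m ↑ʳ x) (m ↑ʳ y) → H.Adj x y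
    drop x y xy rewrite Fin.splitAt-↑ʳ m n x | Fin.splitAt-↑ʳ m n y with inj₂ adj ← xy = adj

    stay : ∀ x z → Graph.Adj (G ∪ᴳ H) (m ↑ʳ x) z → ∃[ y ] m ↑ʳ y ≡ z
    stay x z xz rewrite Fin.splitAt-↑ʳ m n x with splitAt m z in eq | xz
    ... | inj₂ y | inj₂ _ = y , Fin.splitAt⁻¹-↑ʳ eq

  ∪ᴳ-wins : ∀ {a a′ b} → 0 < a → 0 < b → AliceWinsAliceStart G a b → AliceWinsAliceStart H a′ b →
            AliceWinsAliceStart (G ∪ᴳ H) (a + a′) b
  ∪ᴳ-wins {a} {a′} {b} 0<a 0<b σ τ =
    invariant⇒strategy {I = Both} (ℕ.<-≤-trans 0<a (ℕ.m≤m+n a a′)) 0<b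
    record
      { alice-step = λ (i , j) →
          let S , S⊆ , ∣S∣≤ , i′ = shadow-alice G (G ∪ᴳ H) (link left) a b i
              T , T⊆ , ∣T∣≤ , j′ = shadow-alice H (G ∪ᴳ H) (link right) a′ b j
          in S ∪ T , ∪-lub S⊆ T⊆ ,
             ℕ.≤-trans (∣p∪q∣≤∣p∣+∣q∣ S T) (ℕ.+-mono-≤ ∣S∣≤ ∣T∣≤) ,
             -- For each virtual game, the vertices coloured for the other are merely extra red
             -- ones.
             λ R⊆ S∪T⊆ → i′ R⊆ (S∪T⊆ ∘ p⊆p∪q T) , j′ R⊆ (S∪T⊆ ∘ q⊆p∪q S T)
      ; bob-step   = λ (i , j) T⊆ ∣T∣≤ →
          shadow-bob G (G ∪ᴳ H) (link left) a b i T⊆ ∣T∣≤ , shadow-bob H (G ∪ᴳ H) (link right) a′ b j T⊆ ∣T∣≤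
      ; full⇒won   = λ (i , j) full D cl → let v , v∈D = clique-nonempty (G ∪ᴳ H) cl in
          met i j full cl v∈D (splitAt m v) refl
      }
    (shadow-start G (G ∪ᴳ H) (link left) a b σ , shadow-start H (G ∪ᴳ H) (link right) a′ b τ)
    where
    Both : Player → (R B : VertexSet (G ∪ᴳ H)) → Set
    Both p R B = Shadow G (G ∪ᴳ H) (link left) a b p R B × Shadow H (G ∪ᴳ H) (link right) a′ b p R B

    -- The side of a single vertex of the clique decides which virtual game supplies its red vertex.
    met : ∀ {p R B D v} → Shadow G (G ∪ᴳ H) (link left) a b p R B → Shadow H (G ∪ᴳ H) (link right) a′ b p R B →
          Empty (unplayed (G ∪ᴳ H) R B) → IsClique (G ∪ᴳ H) D → v ∈ D →
          ∀ s → splitAt m v ≡ s → Nonempty (R ∩ D)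
    met {D = D} i j full cl v∈D (inj₁ x) eq =
      component-clique-red left i full cl (subst (_∈ D) (sym (Fin.splitAt⁻¹-↑ˡ eq)) v∈D)
    met {D = D} i j full cl v∈D (inj₂ y) eq =
      component-clique-red right j full cl (subst (_∈ D) (sym (Fin.splitAt⁻¹-↑ʳ eq)) v∈D)

-- Comparison of thresholds.

component-a₁≤ : ∀ {G K} → Component G K → a₁ G ≤ a₁ K
component-a₁≤ {G} {K} E =
  let 0<k , wins , _ = a₁-isThreshold K
      _ , _ , least = a₁-isThreshold G
  in least (a₁ K) 0<k (component-wins E 0<k (s≤s z≤n) wins)

proposition3p1 : (G₁ G₂ : Graph) →
    (a₁ G₁ ⊔ a₁ G₂ ≤ a₁ (G₁ ∪ᴳ G₂)) × (a₁ (G₁ ∪ᴳ G₂) ≤ a₁ G₁ + a₁ G₂)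
proposition3p1 G₁ G₂ =
  let 0<a , wins₁ , _ = a₁-isThreshold G₁
      _ , wins₂ , _ = a₁-isThreshold G₂
      _ , _ , least = a₁-isThreshold (G₁ ∪ᴳ G₂)
  in ℕ.⊔-lub (component-a₁≤ (left G₁ G₂)) (component-a₁≤ (right G₁ G₂)) ,
     least (a₁ G₁ + a₁ G₂) (ℕ.<-≤-trans 0<a (ℕ.m≤m+n _ _))
       (∪ᴳ-wins G₁ G₂ 0<a (s≤s z≤n) wins₁ wins₂)
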